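{- For every integer $n \ge 1$, let $M_n = 2^n - 1$ be the $n$-th (non-zero) Mersenne number. Then, with $m = \lceil n/2 \rceil$, $$DS(M_n) = M_n + M_m + 1 = M_n + 2^m,$$ where $DS$ denotes the Dyck successor function.
   Context: A Dyck number is a natural number in whose binary expansion (written without leading zeros) every suffix (final fragment, i.e. block of least significant digits) contains at most as many digits $0$ as digits $1$. By convention $0$ is also a Dyck number (its binary expansion is regarded as empty). In increasing order the Dyck numbers are $0, 1, 3, 5, 7, 11, 13, 15, 19, 21, 23, 27, 29, 31, 39, \dots$ (OEIS A036991). The Mersenne numbers are $M_k = 2^k - 1$ for $k \ge 0$; all of them are Dyck numbers. The Dyck successor function $DS$ sends a Dyck number $d$ to the next one, i.e. $DS(d)$ is the smallest Dyck number strictly greater than $d$. -}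

module Defs where

open import Data.Digit using (Bit; 0b; 1b; fromDigits)
open import Data.Empty using (⊥-elim)
open import Data.Fin using (zero; suc; toℕ)
import Data.Fin as Fin
open import Data.List using (List; []; _∷_; _∷ʳ_; filter; head; length; replicate; reverse; tails)
open import Data.List.Properties using (reverse-++)
open import Data.List.Relation.Unary.All using (All; []; _∷_; all?)
open import Data.List.Reverse using (Reverse; reverseView; []; _∶_∶ʳ_)
open import Data.Maybe using (just)
open import Data.Nat using (ℕ; zero; suc; _+_; _*_; _∸_; _^_; _≤_; _<_; _≤?_; _<?_; z≤n; s≤s)
open import Data.Nat.DivMod using (_divMod_; result)
open import Data.Nat.Induction using (<-rec)
open import Data.Nat.Properties
open import Data.Product using (∃; _×_; _,_; proj₁; proj₂)
open import Relation.Binary.PropositionalEquality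
  using (_≡_; _≢_; refl; sym; trans; cong; cong₂; subst; module ≡-Reasoning)
open import Relation.Nullary using (yes; no)
open import Relation.Nullary.Decidable using (_×-dec_)
open import Relation.Unary using (Decidable)

-- Digits are written most significant first; `fromDigits` expects the least
-- significant digit first, hence the reversal.  The expansion of 0 is [].

record BinaryExpansion (n : ℕ) : Set where
  field
    digits        : List Bit
    value         : fromDigits (reverse digits) ≡ n
    noLeadingZero : head digits ≢ just 0b

open BinaryExpansion public

fromDigits-∷ʳ : ∀ xs (r : Bit) →
  fromDigits (reverse (xs ∷ʳ r)) ≡ toℕ r + fromDigits (reverse xs) * 2
fromDigits-∷ʳ xs r = cong fromDigits (reverse-++ xs (r ∷ []))

head-∷ʳ : ∀ xs (r : Bit) → head xs ≢ just 0b →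
  0 < toℕ r + fromDigits (reverse xs) * 2 → head (xs ∷ʳ r) ≢ just 0b
head-∷ʳ []       zero ok () eq
head-∷ʳ []       (suc r) ok _ ()
head-∷ʳ (x ∷ xs) r ok _ = ok

expansion-∷ʳ : ∀ {q} → BinaryExpansion q → (r : Bit) →
  0 < toℕ r + q * 2 → BinaryExpansion (toℕ r + q * 2)
expansion-∷ʳ e r pos = record
  { digits        = digits e ∷ʳ r
  ; value         = trans (fromDigits-∷ʳ (digits e) r) (cong (λ q → toℕ r + q * 2) (value e))
  ; noLeadingZero = head-∷ʳ (digits e) r (noLeadingZero e)
      (subst (λ q → 0 < toℕ r + q * 2) (sym (value e)) pos)
  }

quotient< : ∀ q r → 0 < r + q * 2 → q < r + q * 2
quotient< zero    r pos = pos
quotient< (suc q) r pos = ≤-trans (s≤s (s≤s (m≤m*n q 2))) (m≤n+m _ r)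

binaryExpansion : ∀ n → BinaryExpansion n
binaryExpansion = <-rec BinaryExpansion step
  where
  step : ∀ n → (∀ {m} → m < n → BinaryExpansion m) → BinaryExpansion n
  step zero      rec = record { digits = [] ; value = refl ; noLeadingZero = λ () }
  step n@(suc _) rec with n divMod 2
  ... | result q r eq = subst BinaryExpansion (sym eq) (expansion-∷ʳ (rec q<n) r pos)
    where
    pos : 0 < toℕ r + q * 2
    pos = subst (0 <_) eq (s≤s z≤n)
    q<n : q < n
    q<n = subst (q <_) (sym eq) (quotient< q (toℕ r) pos)

head-init : ∀ xs (r : Bit) → head (xs ∷ʳ r) ≢ just 0b → head xs ≢ just 0b
head-init []       r ok ()
head-init (x ∷ xs) r ok = ok

positive : ∀ xs (r : Bit) → Reverse xs → head (xs ∷ʳ r) ≢ just 0b →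
  fromDigits (reverse (xs ∷ʳ r)) ≢ 0
positive xs (suc zero) _ ok eq with trans (sym (fromDigits-∷ʳ xs (suc zero))) eq
... | ()
positive .[] zero [] ok eq = ok refl
positive .(xs ∷ʳ r) zero (xs ∶ rs ∶ʳ r) ok eq =
  positive xs r rs (head-init (xs ∷ʳ r) zero ok)
    (m*n≡0⇒m≡0 _ 2 (trans (sym (fromDigits-∷ʳ (xs ∷ʳ r) zero)) eq))

divMod-injective : ∀ (r s : Bit) x y →
  toℕ r + x * 2 ≡ toℕ s + y * 2 → r ≡ s × x ≡ y
divMod-injective zero       zero       x y eq = refl , *-cancelʳ-≡ x y 2 eq
divMod-injective (suc zero) (suc zero) x y eq = refl , *-cancelʳ-≡ x y 2 (suc-injective eq)
divMod-injective zero       (suc zero) (suc x) (suc y) eq =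
  divMod-injective zero (suc zero) x y (suc-injective (suc-injective eq)) .proj₁ , cong suc
    (divMod-injective zero (suc zero) x y (suc-injective (suc-injective eq)) .proj₂)
divMod-injective (suc zero) zero       (suc x) (suc y) eq =
  divMod-injective (suc zero) zero x y (suc-injective (suc-injective eq)) .proj₁ , cong suc
    (divMod-injective (suc zero) zero x y (suc-injective (suc-injective eq)) .proj₂)

digits-injective : ∀ {xs ys} → Reverse xs → Reverse ys →
  head xs ≢ just 0b → head ys ≢ just 0b →
  fromDigits (reverse xs) ≡ fromDigits (reverse ys) → xs ≡ ys
digits-injective []             []             _   _   _  = refl
digits-injective []             (ys ∶ rs ∶ʳ s) _   ok′ eq = ⊥-elim (positive ys s rs ok′ (sym eq))
digits-injective (xs ∶ rs ∶ʳ r) []             ok  _   eq = ⊥-elim (positive xs r rs ok eq)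
digits-injective (xs ∶ rs ∶ʳ r) (ys ∶ ss ∶ʳ s) ok  ok′ eq
  with divMod-injective r s (fromDigits (reverse xs)) (fromDigits (reverse ys))
         (trans (sym (fromDigits-∷ʳ xs r)) (trans eq (fromDigits-∷ʳ ys s)))
... | r≡s , x≡y = cong₂ _∷ʳ_
  (digits-injective rs ss (head-init xs r ok) (head-init ys s ok′) x≡y) r≡s

digits-unique : ∀ {n} (e f : BinaryExpansion n) → digits e ≡ digits f
digits-unique e f = digits-injective (reverseView (digits e)) (reverseView (digits f))
  (noLeadingZero e) (noLeadingZero f) (trans (value e) (sym (value f)))

binary : ℕ → List Bit
binary n = digits (binaryExpansion n)

#0 #1 : List Bit → ℕ
#0 s = length (filter (Fin._≟ 0b) s)
#1 s = length (filter (Fin._≟ 1b) s)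

-- `tails` lists all suffixes, including the whole list and [].

Dyck : ℕ → Set
Dyck n = All (λ s → #0 s ≤ #1 s) (tails (binary n))

dyck? : Decidable Dyck
dyck? n = all? (λ s → #0 s ≤? #1 s) (tails (binary n))

record DyckNumber : Set where
  constructor mkDyck
  field
    toNat  : ℕ
    isDyck : Dyck toNat

open DyckNumber public

M : ℕ → ℕ
M k = 2 ^ k ∸ 1

1+M : ∀ k → suc (M k) ≡ 2 ^ k
1+M k = m+[n∸m]≡n (m^n>0 2 k)

ones-∷ʳ : ∀ k → replicate k 1b ∷ʳ 1b ≡ replicate (suc k) 1b
ones-∷ʳ zero    = refl
ones-∷ʳ (suc k) = cong (1b ∷_) (ones-∷ʳ k)

1+fromDigits-ones : ∀ k → suc (fromDigits (reverse (replicate k 1b))) ≡ 2 ^ k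
1+fromDigits-ones zero    = refl
1+fromDigits-ones (suc k) = begin
  suc (fromDigits (reverse (replicate (suc k) 1b)))     ≡⟨ cong (λ z → suc (fromDigits (reverse z))) (ones-∷ʳ k) ⟨
  suc (fromDigits (reverse (replicate k 1b ∷ʳ 1b)))     ≡⟨ cong suc (fromDigits-∷ʳ (replicate k 1b) 1b) ⟩
  suc (fromDigits (reverse (replicate k 1b))) * 2       ≡⟨ cong (_* 2) (1+fromDigits-ones k) ⟩
  2 ^ k * 2                                             ≡⟨ *-comm (2 ^ k) 2 ⟩
  2 ^ suc k                                             ∎
  where open ≡-Reasoning

head-ones : ∀ k → head (replicate k 1b) ≢ just 0b
head-ones zero    ()
head-ones (suc k) ()

ones-expansion : ∀ k → BinaryExpansion (M k)
ones-expansion k = record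
  { digits        = replicate k 1b
  ; value         = suc-injective (trans (1+fromDigits-ones k) (sym (1+M k)))
  ; noLeadingZero = head-ones k
  }

#0-ones : ∀ k → #0 (replicate k 1b) ≡ 0
#0-ones zero    = refl
#0-ones (suc k) = #0-ones k

tails-ones : ∀ k → All (λ s → #0 s ≤ #1 s) (tails (replicate k 1b))
tails-ones zero    = z≤n ∷ []
tails-ones (suc k) = subst (_≤ #1 (replicate (suc k) 1b)) (sym (#0-ones k)) z≤n ∷ tails-ones k

n≤M : ∀ n → n ≤ M n
n≤M zero    = z≤n
n≤M (suc n) = +-cancelˡ-≤ 1 _ _ (begin
  suc (suc n)          ≤⟨ s≤s (s≤s (n≤M n)) ⟩
  suc (suc (M n))      ≡⟨ cong suc (1+M n) ⟩
  1 + 2 ^ n            ≤⟨ +-monoˡ-≤ (2 ^ n) (m^n>0 2 n) ⟩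
  2 ^ n + 2 ^ n        ≡⟨ cong (2 ^ n +_) (+-identityʳ (2 ^ n)) ⟨
  2 ^ suc n            ≡⟨ 1+M (suc n) ⟨
  suc (M (suc n))      ∎)
  where open ≤-Reasoning

M-dyck : ∀ k → Dyck (M k)
M-dyck k = subst (λ ds → All (λ s → #0 s ≤ #1 s) (tails ds))
  (digits-unique (ones-expansion k) (binaryExpansion (M k))) (tails-ones k)

mersenne : ℕ → DyckNumber
mersenne k = mkDyck (M k) (M-dyck k)

IsLeast : (ℕ → Set) → ℕ → Set
IsLeast P e = P e × (∀ e′ → P e′ → e ≤ e′)

least : ∀ {P : ℕ → Set} → Decidable P → ∀ k → P k → ∃ (IsLeast P)
least {P} P? = <-rec (λ k → P k → ∃ (IsLeast P)) step
  where
  step : ∀ k → (∀ {j} → j < k → P j → ∃ (IsLeast P)) → P k → ∃ (IsLeast P)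
  step k rec pk with anyUpTo? P? k
  ... | yes (j , j<k , pj) = rec j<k pj
  ... | no  none           = k , pk , λ e pe → ≮⇒≥ (λ e<k → none (e , e<k , pe))

-- The search for a successor is bounded by the Mersenne number M (d + 1) > d.

dyckSuccessor : (d : DyckNumber) → ∃ (IsLeast (λ e → toNat d < e × Dyck e))
dyckSuccessor (mkDyck d _) =
  least (λ e → (d <? e) ×-dec dyck? e) (M (suc d)) (n≤M (suc d) , M-dyck (suc d))

DS : DyckNumber → DyckNumber
DS d = let (e , (_ , e-dyck) , _) = dyckSuccessor d in mkDyck e e-dyck

{-# OPTIONS --safe #-}
-- 2 ^ n + M ⌈ n /2⌉ has digits 1 0…0 1…1 with ⌊ n /2⌋ zeros, so it is Dyck.
-- Conversely, let s consist of the last n digits of a Dyck number e ≥ 2 ^ n.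
-- At least half of s is 1s, and a string containing j ones has value at least
-- M j, so e ≥ 2 ^ n + M ⌈ n /2⌉.
module Submission where

open import Defs
open import Data.Digit using (Bit; 0b; 1b; Expansion; fromDigits)
open import Data.Fin using (zero; suc; toℕ)
import Data.Fin as Fin
open import Data.List using (List; []; _∷_; _++_; [_]; drop; length; replicate; reverse; tails; take)
open import Data.List.Properties
  using (length-drop; length-filter; length-replicate; length-reverse; reverse-++; take++drop≡id)
open import Data.List.Relation.Unary.All using (All; []; _∷_)
open import Data.Nat using (ℕ; zero; suc; _+_; _*_; _∸_; _^_; _≤_; _<_; z≤n; s≤s; ≢-nonZero; ⌈_/2⌉; ⌊_/2⌋)
open import Data.Nat.Properties
open import Data.Nat.Tactic.RingSolver using (solve-∀)
open import Data.Product using (_×_; _,_)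
open import Relation.Binary.PropositionalEquality
  using (_≡_; _≢_; refl; sym; trans; cong; cong₂; subst; module ≡-Reasoning)

-- Values of digit strings under concatenation.

fromDigits-++ : ∀ {b} (xs ys : Expansion b) →
  fromDigits (xs ++ ys) ≡ fromDigits xs + fromDigits ys * b ^ length xs
fromDigits-++     []       ys = sym (*-identityʳ _)
fromDigits-++ {b} (x ∷ xs) ys = begin
  toℕ x + fromDigits (xs ++ ys) * b
    ≡⟨ cong (λ v → toℕ x + v * b) (fromDigits-++ xs ys) ⟩
  toℕ x + (fromDigits xs + fromDigits ys * b ^ length xs) * b
    ≡⟨ rearrange (toℕ x) (fromDigits xs) (fromDigits ys) (b ^ length xs) b ⟩
  toℕ x + fromDigits xs * b + fromDigits ys * (b * b ^ length xs) ∎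
  where
  open ≡-Reasoning
  rearrange : ∀ d u v p b → d + (u + v * p) * b ≡ d + u * b + v * (b * p)
  rearrange = solve-∀

⟦_⟧ : List Bit → ℕ
⟦ ds ⟧ = fromDigits (reverse ds)

⟦++⟧ : ∀ ds es → ⟦ ds ++ es ⟧ ≡ ⟦ es ⟧ + ⟦ ds ⟧ * 2 ^ length es
⟦++⟧ ds es = begin
  fromDigits (reverse (ds ++ es))          ≡⟨ cong fromDigits (reverse-++ ds es) ⟩
  fromDigits (reverse es ++ reverse ds)    ≡⟨ fromDigits-++ (reverse es) (reverse ds) ⟩
  ⟦ es ⟧ + ⟦ ds ⟧ * 2 ^ length (reverse es) ≡⟨ cong (λ l → ⟦ es ⟧ + ⟦ ds ⟧ * 2 ^ l) (length-reverse es) ⟩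
  ⟦ es ⟧ + ⟦ ds ⟧ * 2 ^ length es          ∎
  where open ≡-Reasoning

⟦0∷⟧ : ∀ ds → ⟦ 0b ∷ ds ⟧ ≡ ⟦ ds ⟧
⟦0∷⟧ ds = trans (⟦++⟧ [ 0b ] ds) (+-identityʳ _)

⟦1∷⟧ : ∀ ds → ⟦ 1b ∷ ds ⟧ ≡ ⟦ ds ⟧ + 2 ^ length ds
⟦1∷⟧ ds = trans (⟦++⟧ [ 1b ] ds) (cong (⟦ ds ⟧ +_) (*-identityˡ _))

n+n≡2*n : ∀ n → n + n ≡ 2 * n
n+n≡2*n n = cong (n +_) (sym (+-identityʳ n))

-- Bounds on the value of a digit string.

⟦⟧<2^length : ∀ ds → ⟦ ds ⟧ < 2 ^ length ds
⟦⟧<2^length []             = s≤s z≤n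
⟦⟧<2^length (zero ∷ ds)    = begin-strict
  ⟦ 0b ∷ ds ⟧       ≡⟨ ⟦0∷⟧ ds ⟩
  ⟦ ds ⟧            <⟨ ⟦⟧<2^length ds ⟩
  2 ^ length ds     ≤⟨ m≤m+n _ _ ⟩
  2 * 2 ^ length ds ∎
  where open ≤-Reasoning
⟦⟧<2^length (suc zero ∷ ds) = begin-strict
  ⟦ 1b ∷ ds ⟧                   ≡⟨ ⟦1∷⟧ ds ⟩
  ⟦ ds ⟧ + 2 ^ length ds        <⟨ +-monoˡ-< _ (⟦⟧<2^length ds) ⟩
  2 ^ length ds + 2 ^ length ds ≡⟨ n+n≡2*n (2 ^ length ds) ⟩
  2 * 2 ^ length ds             ∎
  where open ≤-Reasoning

-- A leading 1 doubles the left side and adds `2 ^ length ds` to the value, which suffices because a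
-- string has at most as many ones as digits. Adding 1 on the right keeps truncated subtraction out
-- of the induction.
2^#1≤1+⟦⟧ : ∀ ds → 2 ^ #1 ds ≤ suc ⟦ ds ⟧
2^#1≤1+⟦⟧ []             = s≤s z≤n
2^#1≤1+⟦⟧ (zero ∷ ds)    = begin
  2 ^ #1 ds       ≤⟨ 2^#1≤1+⟦⟧ ds ⟩
  suc ⟦ ds ⟧      ≡⟨ cong suc (⟦0∷⟧ ds) ⟨
  suc ⟦ 0b ∷ ds ⟧ ∎
  where open ≤-Reasoning
2^#1≤1+⟦⟧ (suc zero ∷ ds) = begin
  2 * 2 ^ #1 ds              ≡⟨ n+n≡2*n (2 ^ #1 ds) ⟨
  2 ^ #1 ds + 2 ^ #1 ds      ≤⟨ +-mono-≤ (2^#1≤1+⟦⟧ ds) (^-monoʳ-≤ 2 (length-filter (Fin._≟ 1b) ds)) ⟩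
  suc ⟦ ds ⟧ + 2 ^ length ds ≡⟨ cong suc (⟦1∷⟧ ds) ⟨
  suc ⟦ 1b ∷ ds ⟧            ∎
  where open ≤-Reasoning

-- Lower bound for Dyck numbers.

#0+#1≡length : ∀ ds → #0 ds + #1 ds ≡ length ds
#0+#1≡length []              = refl
#0+#1≡length (zero ∷ ds)     = cong suc (#0+#1≡length ds)
#0+#1≡length (suc zero ∷ ds) = trans (+-suc _ _) (cong suc (#0+#1≡length ds))

All-tails-drop : ∀ {A : Set} {P : List A → Set} k xs → All P (tails xs) → P (drop k xs)
All-tails-drop zero    []       (p ∷ _)  = p
All-tails-drop zero    (x ∷ xs) (p ∷ _)  = p
All-tails-drop (suc k) []       (p ∷ _)  = p
All-tails-drop (suc k) (x ∷ xs) (_ ∷ ps) = All-tails-drop k xs ps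

-- Replace `a` by `b` and halve `b + b`. With `a` zeros and `b` ones, this makes at least half of
-- the digits ones, rounded up.
a≤b⇒⌈a+b/2⌉≤b : ∀ {a b} → a ≤ b → ⌈ a + b /2⌉ ≤ b
a≤b⇒⌈a+b/2⌉≤b {a} {b} a≤b = ≤-trans (⌈n/2⌉-mono (+-monoˡ-≤ b a≤b)) (≤-reflexive (sym (n≡⌈n+n/2⌉ b)))

-- Cut the digits of `e` before the last `n`: the nonzero part `high` contributes at least `2 ^ n`,
-- and `low` at least `M ⌈ n /2⌉`.
dyck-lower-bound : ∀ n e → 2 ^ n ≤ e → Dyck e → 2 ^ n + M ⌈ n /2⌉ ≤ e
dyck-lower-bound n e 2^n≤e dyck = begin
  2 ^ n + M ⌈ n /2⌉      ≤⟨ +-monoʳ-≤ (2 ^ n) M≤⟦low⟧ ⟩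
  2 ^ n + ⟦ low ⟧        ≡⟨ +-comm (2 ^ n) _ ⟩
  ⟦ low ⟧ + 2 ^ n        ≤⟨ +-monoʳ-≤ ⟦ low ⟧ (m≤n*m _ ⟦ high ⟧ {{≢-nonZero ⟦high⟧≢0}}) ⟩
  ⟦ low ⟧ + ⟦ high ⟧ * 2 ^ n ≡⟨ split ⟨
  e                      ∎
  where
  open ≤-Reasoning
  ds   = binary e
  k    = length ds ∸ n
  high = take k ds
  low  = drop k ds

  ⟦ds⟧≡e : ⟦ ds ⟧ ≡ e
  ⟦ds⟧≡e = value (binaryExpansion e)

  -- With at most `n` digits, `e` would be below `2 ^ n`. Hence the subtraction in `k` does not
  -- truncate and `low` has exactly `n` digits.
  n<length : n < length ds
  n<length = ≰⇒> λ length≤n → <-irrefl refl (begin-strict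
    e             ≡⟨ ⟦ds⟧≡e ⟨
    ⟦ ds ⟧        <⟨ ⟦⟧<2^length ds ⟩
    2 ^ length ds ≤⟨ ^-monoʳ-≤ 2 length≤n ⟩
    2 ^ n         ≤⟨ 2^n≤e ⟩
    e             ∎)

  length-low : length low ≡ n
  length-low = trans (length-drop k ds) (m∸[m∸n]≡n (<⇒≤ n<length))

  split : e ≡ ⟦ low ⟧ + ⟦ high ⟧ * 2 ^ n
  split = begin-equality
    e                                     ≡⟨ ⟦ds⟧≡e ⟨
    ⟦ ds ⟧                                ≡⟨ cong ⟦_⟧ (take++drop≡id k ds) ⟨
    ⟦ high ++ low ⟧                       ≡⟨ ⟦++⟧ high low ⟩
    ⟦ low ⟧ + ⟦ high ⟧ * 2 ^ length low   ≡⟨ cong (λ l → ⟦ low ⟧ + ⟦ high ⟧ * 2 ^ l) length-low ⟩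
    ⟦ low ⟧ + ⟦ high ⟧ * 2 ^ n            ∎

  -- Otherwise `e` would equal the value of `low`, an `n`-digit string, hence be below `2 ^ n`.
  ⟦high⟧≢0 : ⟦ high ⟧ ≢ 0
  ⟦high⟧≢0 ⟦high⟧≡0 = <-irrefl refl (begin-strict
    e                          ≡⟨ split ⟩
    ⟦ low ⟧ + ⟦ high ⟧ * 2 ^ n ≡⟨ cong (λ h → ⟦ low ⟧ + h * 2 ^ n) ⟦high⟧≡0 ⟩
    ⟦ low ⟧ + 0                ≡⟨ +-identityʳ _ ⟩
    ⟦ low ⟧                    <⟨ ⟦⟧<2^length low ⟩
    2 ^ length low             ≡⟨ cong (2 ^_) length-low ⟩
    2 ^ n                      ≤⟨ 2^n≤e ⟩
    e                          ∎)

  ⌈n/2⌉≤#1 : ⌈ n /2⌉ ≤ #1 low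
  -- The Dyck condition enters here, applied to the suffix `low`.
  ⌈n/2⌉≤#1 = subst (λ l → ⌈ l /2⌉ ≤ #1 low) (trans (#0+#1≡length low) length-low)
    (a≤b⇒⌈a+b/2⌉≤b (All-tails-drop k ds dyck))

  M≤⟦low⟧ : M ⌈ n /2⌉ ≤ ⟦ low ⟧
  M≤⟦low⟧ = ∸-monoˡ-≤ 1 (≤-trans (^-monoʳ-≤ 2 ⌈n/2⌉≤#1) (2^#1≤1+⟦⟧ low))

-- The number with digits 1 0...0 1...1.

zeros-ones : ℕ → ℕ → List Bit
zeros-ones k m = replicate k 0b ++ replicate m 1b

length-zeros-ones : ∀ k m → length (zeros-ones k m) ≡ k + m
length-zeros-ones zero    m = length-replicate m
length-zeros-ones (suc k) m = cong suc (length-zeros-ones k m)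

#0-zeros-ones : ∀ k m → #0 (zeros-ones k m) ≡ k
#0-zeros-ones zero    m = #0-ones m
#0-zeros-ones (suc k) m = cong suc (#0-zeros-ones k m)

#1-zeros-ones : ∀ k m → #1 (zeros-ones k m) ≡ m
#1-zeros-ones k m = +-cancelˡ-≡ k _ _ (begin
  k + #1 (zeros-ones k m)                   ≡⟨ cong (_+ #1 (zeros-ones k m)) (#0-zeros-ones k m) ⟨
  #0 (zeros-ones k m) + #1 (zeros-ones k m) ≡⟨ #0+#1≡length (zeros-ones k m) ⟩
  length (zeros-ones k m)                   ≡⟨ length-zeros-ones k m ⟩
  k + m                                     ∎)
  where open ≡-Reasoning

⟦zeros-ones⟧ : ∀ k m → ⟦ zeros-ones k m ⟧ ≡ M m
⟦zeros-ones⟧ zero    m = value (ones-expansion m)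
⟦zeros-ones⟧ (suc k) m = trans (⟦0∷⟧ (zeros-ones k m)) (⟦zeros-ones⟧ k m)

zeros≤ones : ∀ {k m} → k ≤ m → #0 (zeros-ones k m) ≤ #1 (zeros-ones k m)
zeros≤ones {k} {m} k≤m =
  ≤-trans (≤-reflexive (#0-zeros-ones k m)) (≤-trans k≤m (≤-reflexive (sym (#1-zeros-ones k m))))

-- Dropping a leading zero leaves a string of the same shape with a smaller `k`; once the zeros are
-- gone, only ones remain.
tails-zeros-ones : ∀ {k m} → k ≤ m → All (λ s → #0 s ≤ #1 s) (tails (zeros-ones k m))
tails-zeros-ones {zero}  {m} _   = tails-ones m
tails-zeros-ones {suc k} {m} k<m = zeros≤ones k<m ∷ tails-zeros-ones (<⇒≤ k<m)

one-zeros-ones-expansion : ∀ k m → BinaryExpansion (2 ^ (k + m) + M m)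
one-zeros-ones-expansion k m = record
  { digits        = 1b ∷ zeros-ones k m
  ; value         = begin
      ⟦ 1b ∷ zeros-ones k m ⟧                            ≡⟨ ⟦1∷⟧ (zeros-ones k m) ⟩
      ⟦ zeros-ones k m ⟧ + 2 ^ length (zeros-ones k m)   ≡⟨ cong₂ (λ v l → v + 2 ^ l) (⟦zeros-ones⟧ k m) (length-zeros-ones k m) ⟩
      M m + 2 ^ (k + m)                                  ≡⟨ +-comm (M m) _ ⟩
      2 ^ (k + m) + M m                                  ∎
  ; noLeadingZero = λ ()
  }
  where open ≡-Reasoning

one-zeros-ones-dyck : ∀ {k m} → k ≤ m → Dyck (2 ^ (k + m) + M m)
one-zeros-ones-dyck {k} {m} k≤m = subst (λ ds → All (λ s → #0 s ≤ #1 s) (tails ds))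
  -- `Dyck` refers to the computed expansion; uniqueness identifies it with the explicit one.
  (digits-unique (one-zeros-ones-expansion k m) (binaryExpansion _))
  (m≤n⇒m≤1+n (zeros≤ones k≤m) ∷ tails-zeros-ones k≤m)

-- The successor of a Mersenne number.

DS-unique : ∀ d e → IsLeast (λ e′ → toNat d < e′ × Dyck e′) e → toNat (DS d) ≡ e
DS-unique d e (e-ok , e-least) =
  -- Two least elements bound each other, so the search behind `DS` need not be unfolded.
  let (e′ , e′-ok , e′-least) = dyckSuccessor d in ≤-antisym (e′-least e e-ok) (e-least e′ e′-ok)

theorem5 : (n : ℕ) → 1 ≤ n → let m = ⌈ n /2⌉ in
    (toNat (DS (mersenne n)) ≡ M n + M m + 1) × (M n + M m + 1 ≡ M n + 2 ^ m)
theorem5 n _ =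
    trans (DS-unique (mersenne n) (2 ^ n + M m) ((M<e , e-dyck) , e-least)) e≡
  , trans (+-assoc (M n) (M m) 1) (cong (M n +_) (trans (+-comm (M m) 1) (1+M m)))
  where
  m = ⌈ n /2⌉

  e≡ : 2 ^ n + M m ≡ M n + M m + 1
  e≡ = trans (cong (_+ M m) (sym (1+M n))) (+-comm 1 (M n + M m))

  M<e : M n < 2 ^ n + M m
  M<e = ≤-trans (≤-reflexive (1+M n)) (m≤m+n _ _)

  e-dyck : Dyck (2 ^ n + M m)
  -- Take `⌊ n /2⌋` zeros and `⌈ n /2⌉` ones after the leading 1: they fill `n` places, and the
  -- zeros do not outnumber the ones.
  e-dyck = subst (λ l → Dyck (2 ^ l + M m)) (⌊n/2⌋+⌈n/2⌉≡n n) (one-zeros-ones-dyck (⌊n/2⌋≤⌈n/2⌉ n))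

  e-least : ∀ e′ → M n < e′ × Dyck e′ → 2 ^ n + M m ≤ e′
  -- Exceeding `M n` means being at least `suc (M n)`, which is `2 ^ n`.
  e-least e′ (M<e′ , dyck) = dyck-lower-bound n e′ (subst (_≤ e′) (1+M n) M<e′) dyck
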